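{- For any integer $k\geq 1$, let $\mathcal{G}_k$ be the class of triangle-free graphs with treedepth at most $k$. Then the chromatic number, the defective chromatic number and the clustered chromatic number of $\mathcal{G}_k$ are equal, and their common value is at least $(1-o(1))\sqrt{2k}$ and at most $\left\lceil\frac{k+2}{2}\right\rceil$, where $o(1)$ denotes a quantity tending to $0$ as $k\to\infty$.
   Context: Graphs are finite, simple and undirected. A $k$-colouring of a graph assigns one of at most $k$ colours to each vertex (not necessarily properly). A monochromatic component is a connected component of the subgraph induced by all vertices of a single colour. A colouring has defect $d$ if every monochromatic component has maximum degree at most $d$, and has clustering $c$ if every monochromatic component has at most $c$ vertices. For a graph class $\mathcal{G}$: the chromatic number of $\mathcal{G}$ is $\max\{\chi(G):G\in\mathcal{G}\}$, where $\chi(G)$ is the usual (proper) chromatic number; the defective chromatic number of $\mathcal{G}$ is the minimum integer $k$ for which there exists an integer $d$ such that every graph in $\mathcal{G}$ is $k$-colourable with defect $d$; the clustered chromatic number of $\mathcal{G}$ is the minimum integer $k$ for which there exists an integer $c$ such that every graph in $\mathcal{G}$ is $k$-colourable with clustering $c$. (Each is called unbounded if the relevant maximum or minimum does not exist.) In a rooted tree, the depth of a vertex $v$ is the number of vertices on the path from the root to $v$; the depth of a rooted forest is the maximum depth of its vertices; the closure of a rooted forest $F$ is the graph on $V(F)$ in which two distinct vertices are adjacent if and only if one is an ancestor of the other. The treedepth of a graph $G$ is the minimum depth of a rooted forest $F$ such that $G$ is a spanning subgraph of the closure of $F$. -}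

module Defs where

open import Data.Empty using (⊥)
open import Data.Fin using (Fin; _≟_)
open import Data.Fin.Subset using (Subset; _∈_; _∩_; ∣_∣)
open import Data.Integer using (+_)
open import Data.List using (map; allFin)
open import Data.List.Extrema.Nat using (max)
open import Data.Maybe using (Maybe; just; nothing)
open import Data.Maybe.Properties using (just-injective)
open import Data.Nat using (ℕ; suc; _≤_; _≥_)
open import Data.Product using (Σ-syntax; ∃-syntax; _×_; _,_)
open import Data.Rational as ℚ using (ℚ; 0ℚ)
open import Data.Sum using (_⊎_; swap)
open import Data.Vec using (tabulate)
open import Function using (_⇔_; _∘_)
open import Induction.WellFounded using (Acc; acc; WellFounded)
open import Level using (Level; 0ℓ)
open import Relation.Binary using (Rel; Decidable; Symmetric)
open import Relation.Binary.Construct.Closure.ReflexiveTransitive using (Star; ε; _◅_)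
open import Relation.Binary.PropositionalEquality using (_≡_; _≢_; refl; sym; trans; subst)
open import Relation.Nullary using (Dec; yes; no; does; ¬_; contradiction; ¬?; _×-dec_; _⊎-dec_)
open import Relation.Unary using (Pred)

private variable
  ℓ : Level
  n c : ℕ

IsMinimum : Pred ℕ ℓ → Pred ℕ ℓ
IsMinimum P m = P m × (∀ j → P j → m ≤ j)

IsMaximum : Pred ℕ ℓ → Pred ℕ ℓ
IsMaximum P m = P m × (∀ j → P j → j ≤ m)

record Graph (n : ℕ) : Set₁ where
  field
    Adj       : Rel (Fin n) 0ℓ
    adj?      : Decidable Adj
    irrefl    : ∀ v → ¬ Adj v v
    symmetric : Symmetric Adj

open Graph public

neighbours : Graph n → Fin n → Subset n
neighbours G v = tabulate (λ w → does (adj? G v w))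

TriangleFree : Graph n → Set
TriangleFree G = ∀ u v w → Adj G u v → Adj G v w → Adj G w u → ⊥

_IsSpanningSubgraphOf_ : Graph n → Graph n → Set
G IsSpanningSubgraphOf H = ∀ u v → Adj G u v → Adj H u v

-- A rooted forest is given by its parent map; the roots are the vertices
-- without a parent, and well-foundedness excludes cycles.
record RootedForest (n : ℕ) : Set where
  field
    parent : Fin n → Maybe (Fin n)

  _IsParentOf_ : Rel (Fin n) 0ℓ
  u IsParentOf v = parent v ≡ just u

  field
    wellFounded : WellFounded _IsParentOf_

  -- Non-strict: every vertex is an ancestor of itself.
  _IsAncestorOf_ : Rel (Fin n) 0ℓ
  u IsAncestorOf v = Star (λ x y → y IsParentOf x) v u

  depthAcc : ∀ v → Acc _IsParentOf_ v → ℕ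
  depthAcc v (acc rs) with parent v
  ... | nothing = 1
  ... | just u  = suc (depthAcc u (rs refl))

  ancestorAcc? : ∀ u v → Acc _IsParentOf_ v → Dec (u IsAncestorOf v)
  ancestorAcc? u v (acc rs) with u ≟ v
  ... | yes refl = yes ε
  ... | no u≢v with parent v in eq
  ...   | nothing = no λ { ε       → u≢v refl
                         ; (e ◅ _) → contradiction (trans (sym eq) e) λ () }
  ...   | just w with ancestorAcc? u w (rs refl)
  ...     | yes p = yes (eq ◅ p)
  ...     | no ¬p = no λ { ε       → u≢v refl
                         ; (e ◅ p) → ¬p (subst (u IsAncestorOf_)
                                           (just-injective (trans (sym e) eq)) p) }

  ancestor? : Decidable _IsAncestorOf_
  ancestor? u v = ancestorAcc? u v (wellFounded v)

  vertexDepth : Fin n → ℕ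
  vertexDepth v = depthAcc v (wellFounded v)

  -- The forest without vertices has depth 0.
  depth : ℕ
  depth = max 0 (map vertexDepth (allFin n))

  closure : Graph n
  closure = record
    { Adj       = λ u v → u ≢ v × (u IsAncestorOf v ⊎ v IsAncestorOf u)
    ; adj?      = λ u v → ¬? (u ≟ v) ×-dec (ancestor? u v ⊎-dec ancestor? v u)
    ; irrefl    = λ { v (v≢v , _) → v≢v refl }
    ; symmetric = λ { (u≢v , a) → u≢v ∘ sym , swap a }
    }

open RootedForest public using (depth; closure)

IsTreedepth : Graph n → ℕ → Set
IsTreedepth {n} G = IsMinimum λ d →
  Σ[ F ∈ RootedForest n ] depth F ≡ d × G IsSpanningSubgraphOf closure F

Colouring : ℕ → ℕ → Set
Colouring n c = Fin n → Fin c

IsProper : Graph n → Colouring n c → Set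
IsProper G f = ∀ u v → Adj G u v → f u ≢ f v

colourClass : Colouring n c → Fin c → Subset n
colourClass f i = tabulate (λ v → does (f v ≟ i))

InducedAdj : Graph n → Subset n → Rel (Fin n) 0ℓ
InducedAdj G S u v = u ∈ S × v ∈ S × Adj G u v

-- C is the vertex set of a connected component of the subgraph induced by S.
IsComponent : Graph n → Subset n → Subset n → Set
IsComponent G S C = ∃[ v ] v ∈ S × (∀ w → w ∈ C ⇔ Star (InducedAdj G S) v w)

IsMonochromaticComponent : Graph n → Colouring n c → Subset n → Set
IsMonochromaticComponent G f C = ∃[ i ] IsComponent G (colourClass f i) C

HasDefect : Graph n → Colouring n c → ℕ → Set
HasDefect G f d = ∀ C → IsMonochromaticComponent G f C →
  ∀ v → v ∈ C → ∣ neighbours G v ∩ C ∣ ≤ d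

HasClustering : Graph n → Colouring n c → ℕ → Set
HasClustering G f s = ∀ C → IsMonochromaticComponent G f C → ∣ C ∣ ≤ s

IsChromaticNumber : Graph n → ℕ → Set
IsChromaticNumber {n} G = IsMinimum λ c → Σ[ f ∈ Colouring n c ] IsProper G f

GraphClass : Set₁
GraphClass = ∀ {n} → Graph n → Set

IsClassChromaticNumber : GraphClass → ℕ → Set₁
IsClassChromaticNumber 𝒢 = IsMaximum λ m →
  Σ[ n ∈ ℕ ] Σ[ G ∈ Graph n ] 𝒢 G × IsChromaticNumber G m

IsDefectiveChromaticNumber : GraphClass → ℕ → Set₁
IsDefectiveChromaticNumber 𝒢 = IsMinimum λ c →
  ∃[ d ] (∀ {n} (G : Graph n) → 𝒢 G → Σ[ f ∈ Colouring n c ] HasDefect G f d)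

IsClusteredChromaticNumber : GraphClass → ℕ → Set₁
IsClusteredChromaticNumber 𝒢 = IsMinimum λ c →
  ∃[ s ] (∀ {n} (G : Graph n) → 𝒢 G → Σ[ f ∈ Colouring n c ] HasClustering G f s)

TriangleFreeTreedepth≤ : ℕ → GraphClass
TriangleFreeTreedepth≤ k G = TriangleFree G × ∃[ t ] IsTreedepth G t × t ≤ k

fromℕ : ℕ → ℚ
fromℕ m = + m ℚ./ 1

TendsToZero : (ℕ → ℚ) → Set
TendsToZero a = ∀ δ → 0ℚ ℚ.< δ → ∃[ K ] (∀ k → k ≥ K → ℚ.∣ a k ∣ ℚ.< δ)

-- The real inequality x · √m ≤ c, squared: it holds trivially for x < 0,
-- and for x ≥ 0 both sides are nonnegative.
_·√_≤_ : ℚ → ℕ → ℕ → Set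
x ·√ m ≤ c = 0ℚ ℚ.≤ x → x ℚ.* x ℚ.* fromℕ m ℚ.≤ fromℕ c ℚ.* fromℕ c

{-# OPTIONS --safe #-}
module Submission where

-- Any graph of treedepth at most k is built top-down along a forest, so it maps
-- into the graph on the full k-level forest in which every vertex has, for each
-- set of depths, a child adjacent to exactly its ancestors at these depths (unless
-- that creates a triangle). If moreover every child has k d + 1 copies, then for
-- any colouring with defect d the map can be chosen to avoid monochromatic edges,
-- since the at most k ancestors rule out at most d copies each. Hence the least
-- number of colours of this graph is the common value χ k of all three numbers.
--
-- Upper bound: colour first-fit from the roots down. If v gets colour l + 1
-- (counting from 0), its neighbours with colours 0, …, l and the neighbours with
-- colours 0, …, l - 1 and l + 1 of the one coloured l are 2 (l + 1) distinct
-- ancestors of v, itself included.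
--
-- Lower bound: given an independent set I of m distinctly coloured vertices on a
-- root path, append vertices, each adjacent to the members of I already exchanged.
-- A new vertex whose colour occurs in I is exchanged for the member of that colour;
-- after at most m exchanges a new colour appears, and its vertex enlarges the set.
-- So χ k ≥ m once k ≥ 1 + 2 + … + m.

open import Defs
open import Data.Nat using (ℕ; zero; suc; _+_; _*_; _^_; _≤_; _<_; _≥_; z≤n; s≤s; s≤s⁻¹; ⌈_/2⌉)
open import Data.Product using (∃; ∃-syntax; Σ-syntax; _×_; _,_; proj₁; proj₂)
open import Data.Rational as ℚ using (ℚ; 1ℚ; _-_; mkℚ; toℚᵘ)

open import Algebra.Bundles using (CommutativeMonoid)
open import Algebra.Properties.CommutativeSemigroup using (interchange)
open import Data.Bool as Bool using (Bool; true; false; if_then_else_)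
open import Data.Empty using (⊥)
open import Data.Fin as Fin using (Fin; zero; suc; toℕ; fromℕ<; combine; remQuot; finToFun; funToFin; splitAt; join)
open import Data.Fin.Properties as Fin using (any?; all?)
open import Data.Fin.Subset using (Subset; inside; outside; _∈_; _∉_; _∩_; _∪_; ⁅_⁆; ∣_∣; ⊤)
  renaming (⊥ to ∅)
open import Data.Fin.Subset.Properties using (_∈?_; ∉⊥; ∈⊤; x∈⁅x⁆; x∈⁅y⁆⇒x≡y; ∣⁅x⁆∣≡1; x∈p∩q⁺; p∩q⊆q;
  x∈p∪q⁺; x∈p∪q⁻; p⊆p∪q; p⊆q⇒∣p∣≤∣q∣; p⊂q⇒∣p∣<∣q∣; ∣p∣≤n; ∣p∣≡n⇒p≡⊤)
open import Data.Integer as ℤ using (+_; +≤+; +<+)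
import Data.Integer.Properties as ℤ
import Data.Integer.Tactic.RingSolver as ℤRing
open import Data.List using (map; allFin)
open import Data.List.Extrema.Nat using (xs≤max; max≤v⁺)
open import Data.List.Membership.Propositional.Properties using (∈-map⁺; ∈-allFin)
open import Data.List.Relation.Unary.All using (lookup; universal)
open import Data.List.Relation.Unary.All.Properties using (map⁺)
open import Data.Maybe as Maybe using (Maybe; just; nothing)
open import Data.Maybe.Properties using (just-injective; ≡-dec)
import Data.Nat.Properties as ℕ
import Data.Nat.Tactic.RingSolver as ℕRing
import Data.Rational.Properties as ℚ
open import Data.Rational.Unnormalised as ℚᵘ using (mkℚᵘ; *≡*; *≤*; *<*)
import Data.Rational.Unnormalised.Properties as ℚᵘ
open import Data.Sum as Sum using (_⊎_; inj₁; inj₂)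
open import Data.Vec using (_∷_; tabulate; here; there)
open import Data.Vec.Properties using (lookup⇒[]=; []=⇒lookup; lookup∘tabulate)
open import Effect.Monad using (RawMonad)
open import Function using (_∘_; id; mk⇔; Injective; Equivalence)
open import Induction.WellFounded using (Acc; acc)
open import Level using (Level; 0ℓ)
open import Relation.Binary using (Decidable)
open import Relation.Binary.Construct.Closure.ReflexiveTransitive as Star using (Star; ε; _◅_; _◅◅_)
open import Relation.Binary.PropositionalEquality using (_≡_; _≢_; _≗_; refl; sym; trans; cong; cong₂; subst; subst₂)
open import Relation.Nullary using (Dec; yes; no; does; ¬_; ¬?; _×-dec_; _⊎-dec_; _→-dec_; contradiction)
open import Relation.Nullary.Decidable using (map′; dec-true; decidable-stable; ¬¬-excluded-middle)
open import Relation.Nullary.Negation using (¬¬-Monad)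
open import Relation.Unary as Unary using (Pred)

private variable
  ℓ : Level
  A B : Set
  m n c : ℕ


-- Least witnesses and finite search.

least : {P : Pred ℕ ℓ} → Unary.Decidable P → ∀ {b} → P b → ∃ (IsMinimum P)
least P? {zero}  p = 0 , p , λ _ _ → z≤n
least P? {suc b} p with P? 0
... | yes p₀ = 0 , p₀ , λ _ _ → z≤n
... | no ¬p₀ with least (P? ∘ suc) p
...   | m , pₘ , min = suc m , pₘ , λ
  { zero    p₀ → contradiction p₀ ¬p₀
  ; (suc j) pⱼ → s≤s (min j pⱼ) }

-- The functions are enumerated through their codes in `Fin (n ^ m)`. Decoding recovers a function
-- only up to pointwise equality, hence the condition that `P` respects it.
anyFunction? : {P : Pred (Fin m → Fin n) ℓ} → (∀ {f g} → f ≗ g → P f → P g) →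
  Unary.Decidable P → Dec (∃ P)
anyFunction? resp P? = map′
  (λ (c , p) → finToFun c , p)
  (λ (f , p) → funToFin f , resp (sym ∘ Fin.finToFun-funToFin f) p)
  (any? (P? ∘ finToFun))

-- Depth, ancestors and recursion in rooted forests.

module ForestProperties {n : ℕ} (F : RootedForest n) where
  open RootedForest F hiding (depth; closure)

  -- `nothing` acts as a virtual parent of all roots, so that roots need no separate treatment.
  height : Maybe (Fin n) → ℕ
  height nothing  = 0
  height (just v) = vertexDepth v

  -- `depthAcc` recurses on the accessibility proof, and the proof reached at a parent `u` need not
  -- be `wellFounded u`; this gives depth its expected recurrence.
  depthAcc-irrelevant : ∀ v (p q : Acc _IsParentOf_ v) → depthAcc v p ≡ depthAcc v q
  depthAcc-irrelevant v (acc rs) (acc rs′) with parent v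
  ... | nothing = refl
  ... | just u  = cong suc (depthAcc-irrelevant u (rs refl) (rs′ refl))

  depthAcc-parent : ∀ v (p : Acc _IsParentOf_ v) → depthAcc v p ≡ suc (height (parent v))
  depthAcc-parent v (acc rs) with parent v
  ... | nothing = refl
  ... | just u  = cong suc (depthAcc-irrelevant u (rs refl) (wellFounded u))

  vertexDepth-parent : ∀ v → vertexDepth v ≡ suc (height (parent v))
  vertexDepth-parent v = depthAcc-parent v (wellFounded v)

  vertexDepth-child : ∀ {u v} → u IsParentOf v → vertexDepth v ≡ suc (vertexDepth u)
  vertexDepth-child {v = v} e = trans (vertexDepth-parent v) (cong (suc ∘ height) e)

  vertexDepth≤depth : ∀ v → vertexDepth v ≤ depth F
  vertexDepth≤depth v =
    lookup (xs≤max 0 (map vertexDepth (allFin n))) (∈-map⁺ vertexDepth (∈-allFin v))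

  depth≤ : ∀ {k} → (∀ v → vertexDepth v ≤ k) → depth F ≤ k
  depth≤ h = max≤v⁺ z≤n (map⁺ (universal h (allFin n)))

  ancestor-depth : ∀ {u v} → u IsAncestorOf v → vertexDepth u ≤ vertexDepth v
  ancestor-depth ε       = ℕ.≤-refl
  ancestor-depth (e ◅ p) = ℕ.≤-trans (ancestor-depth p)
    (ℕ.≤-trans (ℕ.n≤1+n _) (ℕ.≤-reflexive (sym (vertexDepth-child e))))

  properAncestor-depth : ∀ {u v} → u IsAncestorOf v → u ≢ v → vertexDepth u < vertexDepth v
  properAncestor-depth ε       u≢v = contradiction refl u≢v
  properAncestor-depth (e ◅ p) u≢v =
    ℕ.≤-trans (s≤s (ancestor-depth p)) (ℕ.≤-reflexive (sym (vertexDepth-child e)))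

  -- The ancestors of `v` form a path along which depth strictly decreases. This is why labels can
  -- name ancestors by depth and why ancestors can be counted by depth.
  ancestor-unique : ∀ {u v w} → u IsAncestorOf v → w IsAncestorOf v →
    vertexDepth u ≡ vertexDepth w → u ≡ w
  ancestor-unique ε ε _ = refl
  ancestor-unique ε (e ◅ q) eq = contradiction eq
    (ℕ.>⇒≢ (ℕ.≤-trans (s≤s (ancestor-depth q)) (ℕ.≤-reflexive (sym (vertexDepth-child e)))))
  ancestor-unique (e ◅ p) ε eq = contradiction eq
    (ℕ.<⇒≢ (ℕ.≤-trans (s≤s (ancestor-depth p)) (ℕ.≤-reflexive (sym (vertexDepth-child e)))))
  ancestor-unique {u} (e ◅ p) (e′ ◅ q) eq
    with refl ← just-injective (trans (sym e) e′) = ancestor-unique p q eq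

  properAncestor-parent : ∀ {u v} → u IsAncestorOf v → u ≢ v →
    ∃[ w ] w IsParentOf v × u IsAncestorOf w
  properAncestor-parent ε       u≢v = contradiction refl u≢v
  properAncestor-parent (e ◅ p) _   = _ , e , p

  parent-properAncestor : ∀ {u v w} → w IsParentOf v → u IsAncestorOf w →
    u IsAncestorOf v × u ≢ v
  parent-properAncestor {u} e p = e ◅ p , λ { refl → ℕ.<-irrefl refl
    (ℕ.≤-trans (ℕ.≤-reflexive (sym (vertexDepth-child e))) (ancestor-depth p)) }

  -- Choice down the forest, one level at a time. `local` says that `P v` sees `g` only at proper
  -- ancestors of `v`, so later levels cannot disturb it; `g₀` supplies placeholders for the levels
  -- not yet reached.
  forestRec : (Fin n → A) → (P : Fin n → (Fin n → A) → A → Set) →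
    (∀ {v g g′ a} → (∀ {u} → u IsAncestorOf v → u ≢ v → g u ≡ g′ u) → P v g a → P v g′ a) →
    (∀ v g → (∀ {u} → u IsAncestorOf v → u ≢ v → P u g (g u)) → ∃ (P v g)) →
    ∃[ g ] ∀ v → P v g (g v)
  forestRec {A} g₀ P local step with upTo (depth F)
    where
    upTo : ∀ t → ∃[ g ] ∀ v → vertexDepth v ≤ t → P v g (g v)
    upTo zero = g₀ , λ v D≤0 →
      contradiction (ℕ.≤-trans (ℕ.≤-reflexive (sym (vertexDepth-parent v))) D≤0) λ ()
    upTo (suc t) with upTo t
    ... | g , Pg = g′ , Pg′
      where
      next : ∀ v → vertexDepth v ≡ suc t → ∃ (P v g)
      next v D≡ = step v g λ p u≢v →
        Pg _ (s≤s⁻¹ (ℕ.≤-trans (properAncestor-depth p u≢v) (ℕ.≤-reflexive D≡)))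

      g′ : Fin n → A
      g′ v with vertexDepth v ℕ.≟ suc t
      ... | yes D≡ = proj₁ (next v D≡)
      ... | no  _  = g v

      g′-old : ∀ v → vertexDepth v ≤ t → g v ≡ g′ v
      g′-old v D≤t with vertexDepth v ℕ.≟ suc t
      ... | yes D≡ = contradiction D≡ (ℕ.<⇒≢ (s≤s D≤t))
      ... | no  _  = refl

      agree : ∀ {v} → vertexDepth v ≤ suc t → ∀ {u} → u IsAncestorOf v → u ≢ v → g u ≡ g′ u
      agree D≤ p u≢v = g′-old _ (s≤s⁻¹ (ℕ.≤-trans (properAncestor-depth p u≢v) D≤))

      Pg′ : ∀ v → vertexDepth v ≤ suc t → P v g′ (g′ v)
      Pg′ v D≤ with vertexDepth v ℕ.≟ suc t
      ... | yes D≡ = local (agree D≤) (proj₂ (next v D≡))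
      ... | no  D≢ = local (agree D≤) (Pg v (s≤s⁻¹ (ℕ.≤∧≢⇒< D≤ D≢)))
  ... | g , Pg = g , λ v → Pg v (vertexDepth≤depth v)

-- Existence of treedepth by finite search.

fromCode : Fin (suc n) → Maybe (Fin n)
fromCode zero    = nothing
fromCode (suc i) = just i

toCode : Maybe (Fin n) → Fin (suc n)
toCode nothing  = zero
toCode (just i) = suc i

fromCode-toCode : (x : Maybe (Fin n)) → fromCode (toCode x) ≡ x
fromCode-toCode nothing  = refl
fromCode-toCode (just _) = refl

-- A decidable replacement for well-foundedness, which it implies: forests of bounded depth can thus
-- be found by searching through parent maps.
HeightAtMost : (Fin n → Maybe (Fin n)) → ℕ → Pred (Fin n) 0ℓ
HeightAtMost par zero    v = ⊥
HeightAtMost par (suc d) v = ∀ u → par v ≡ just u → HeightAtMost par d u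

heightAtMost? : ∀ (par : Fin n → Maybe (Fin n)) d → Unary.Decidable (HeightAtMost par d)
heightAtMost? par zero    v = no λ ()
heightAtMost? par (suc d) v =
  all? λ u → ≡-dec Fin._≟_ (par v) (just u) →-dec heightAtMost? par d u

heightAtMost-resp : ∀ {par par′ : Fin n → Maybe (Fin n)} → par ≗ par′ →
  ∀ d {v} → HeightAtMost par d v → HeightAtMost par′ d v
heightAtMost-resp eq (suc d) {v} h u e = heightAtMost-resp eq d (h u (trans (eq v) e))

module _ {n : ℕ} (par : Fin n → Maybe (Fin n)) {d : ℕ} (h : ∀ v → HeightAtMost par d v) where

  heightAtMost⇒acc : ∀ d {v} → HeightAtMost par d v → Acc (λ x y → par y ≡ just x) v
  heightAtMost⇒acc (suc d) h = acc λ {u} e → heightAtMost⇒acc d (h u e)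

  boundedForest : RootedForest n
  boundedForest = record { parent = par ; wellFounded = λ v → heightAtMost⇒acc d (h v) }

  boundedForest-depth : depth boundedForest ≤ d
  boundedForest-depth = depth≤ λ v → bound d (h v)
    where
    open RootedForest boundedForest using (vertexDepth)
    open ForestProperties boundedForest
    bound : ∀ d {v} → HeightAtMost par d v → vertexDepth v ≤ d
    bound (suc d) {v} h = subst (_≤ suc d) (sym (vertexDepth-parent v)) (s≤s (rec refl))
      where
      rec : ∀ {x} → par v ≡ x → height x ≤ d
      rec {nothing} _ = z≤n
      rec {just u}  e = bound d (h u e)

heightAtMost-depth : (F : RootedForest n) →
  ∀ v → HeightAtMost (RootedForest.parent F) (depth F) v
heightAtMost-depth F v = bound (depth F) (vertexDepth≤depth v)
  where
  open RootedForest F hiding (depth; closure)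
  open ForestProperties F
  bound : ∀ d {v} → vertexDepth v ≤ d → HeightAtMost parent d v
  bound zero    {v} D≤0 =
    contradiction (ℕ.≤-trans (ℕ.≤-reflexive (sym (vertexDepth-parent v))) D≤0) λ ()
  bound (suc d) D≤ u e =
    bound d (s≤s⁻¹ (ℕ.≤-trans (ℕ.≤-reflexive (sym (vertexDepth-child e))) D≤))

module _ {n : ℕ} (G : Graph n) where

  spanning? : ∀ H → Dec (G IsSpanningSubgraphOf H)
  spanning? H = all? λ u → all? λ v → adj? G u v →-dec adj? H u v

  SpansForest : ℕ → (Fin n → Maybe (Fin n)) → Set
  SpansForest d par = Σ[ h ∈ (∀ v → HeightAtMost par d v) ]
    G IsSpanningSubgraphOf closure (boundedForest par h)

  spansForest? : ∀ d → Unary.Decidable (SpansForest d)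
  spansForest? d par with all? (heightAtMost? par d)
  ... | no ¬h = no (¬h ∘ proj₁)
  ... | yes h = map′ (h ,_) proj₂ (spanning? (closure (boundedForest par h)))

  spansForest-resp : ∀ {d par par′} → par ≗ par′ → SpansForest d par → SpansForest d par′
  spansForest-resp {d} eq (h , s) = (λ v → heightAtMost-resp eq d (h v)) , λ u v a →
    let u≢v , c = s u v a in u≢v , Sum.map respStar respStar c
    where respStar = Star.map λ {x} e → trans (sym (eq x)) e

  HasForest : ℕ → Set
  HasForest d = ∃ (SpansForest d)

  hasForest? : Unary.Decidable HasForest
  hasForest? d = map′
    (λ (p , s) → fromCode ∘ p , s)
    (λ (par , s) → toCode ∘ par , spansForest-resp (sym ∘ fromCode-toCode ∘ par) s)
    (anyFunction? (λ eq → spansForest-resp (cong fromCode ∘ eq)) (λ p → spansForest? d (fromCode ∘ p)))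

  forest⇒hasForest : (F : RootedForest n) → G IsSpanningSubgraphOf closure F →
    HasForest (depth F)
  forest⇒hasForest F s = RootedForest.parent F , heightAtMost-depth F , s

  -- The search finds the least upper bound `t` on the depth of a suitable forest, while
  -- `IsTreedepth` asks for depth exactly `t`; minimality turns the bound into an equality.
  treedepth-exists : (F : RootedForest n) → G IsSpanningSubgraphOf closure F →
    ∃[ t ] IsTreedepth G t × t ≤ depth F
  treedepth-exists F s with least hasForest? (forest⇒hasForest F s)
  ... | t , (par , h , s′) , min =
    t , ((boundedForest par h , ℕ.≤-antisym (boundedForest-depth par h)
            (min _ (forest⇒hasForest (boundedForest par h) s′)) , s′)
        , λ { _ (F′ , refl , s″) → min _ (forest⇒hasForest F′ s″) })
      , min _ (forest⇒hasForest F s)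

-- Triangle-free graphs encoded by labelled forests.

module LabelledForest {n : ℕ} (F : RootedForest n) (label : Fin n → ℕ → Bool) where
  open RootedForest F hiding (depth; closure)
  open ForestProperties F

  _↝_ : Fin n → Fin n → Set
  x ↝ y = y IsAncestorOf x × y ≢ x × label x (vertexDepth y) ≡ true

  _↝?_ : Decidable _↝_
  x ↝? y = ancestor? y x ×-dec ¬? (y Fin.≟ x) ×-dec label x (vertexDepth y) Bool.≟ true

  ↝-depth : ∀ {x y} → x ↝ y → vertexDepth y < vertexDepth x
  ↝-depth (p , y≢x , _) = properAncestor-depth p y≢x

  -- Labels are arbitrary, so a vertex whose label would create a triangle is
  -- given no edges to its ancestors.
  Admissible : Pred (Fin n) 0ℓ
  Admissible x = ∀ y z → x ↝ y → x ↝ z → ¬ (y ↝ z)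

  Edge : Fin n → Fin n → Set
  Edge x y = x ↝ y × Admissible x

  opaque
    edge? : Decidable Edge
    edge? x y = (x ↝? y) ×-dec
      all? λ y → all? λ z → (x ↝? y) →-dec (x ↝? z) →-dec ¬? (y ↝? z)

  labelledGraph : Graph n
  labelledGraph = record
    { Adj       = λ x y → Edge x y ⊎ Edge y x
    ; adj?      = λ x y → edge? x y ⊎-dec edge? y x
    ; irrefl    = λ v → λ { (inj₁ ((_ , v≢v , _) , _)) → v≢v refl
                          ; (inj₂ ((_ , v≢v , _) , _)) → v≢v refl }
    ; symmetric = Sum.swap }

  -- Every edge points towards the root. Two of the eight orientations of a triangle are directed
  -- cycles, excluded by depth; in the others some vertex points to both remaining ones, against its
  -- admissibility.
  labelledGraph-triangleFree : TriangleFree labelledGraph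
  labelledGraph-triangleFree u v w = λ
    { (inj₁ (uv , a)) (inj₁ (vw , _)) (inj₁ (wu , _)) → cyclic uv vw wu
    ; (inj₁ (uv , a)) (inj₁ (vw , _)) (inj₂ (uw , _)) → a v w uv uw vw
    ; (inj₁ (uv , _)) (inj₂ (wv , a)) (inj₁ (wu , _)) → a u v wu wv uv
    ; (inj₁ (uv , a)) (inj₂ (wv , _)) (inj₂ (uw , _)) → a w v uw uv wv
    ; (inj₂ (vu , a)) (inj₁ (vw , _)) (inj₁ (wu , _)) → a w u vw vu wu
    ; (inj₂ (vu , a)) (inj₁ (vw , _)) (inj₂ (uw , _)) → a u w vu vw uw
    ; (inj₂ (vu , _)) (inj₂ (wv , a)) (inj₁ (wu , _)) → a v u wv wu vu
    ; (inj₂ (vu , _)) (inj₂ (wv , a)) (inj₂ (uw , _)) → cyclic uw wv vu }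
    where
    cyclic : ∀ {x y z} → x ↝ y → y ↝ z → z ↝ x → ⊥
    cyclic xy yz zx =
      ℕ.<-asym (ℕ.<-trans (↝-depth yz) (↝-depth xy)) (↝-depth zx)

  labelledGraph⊆closure : labelledGraph IsSpanningSubgraphOf closure F
  labelledGraph⊆closure u v (inj₁ ((p , v≢u , _) , _)) = v≢u ∘ sym , inj₂ p
  labelledGraph⊆closure u v (inj₂ ((p , u≢v , _) , _)) = u≢v , inj₁ p

-- Universal forests.

record UniversalForest (k N : ℕ) : Set where
  field
    order  : ℕ
    forest : RootedForest order
    label  : Fin order → ℕ → Bool

  open RootedForest forest hiding (depth; closure)
  open ForestProperties forest

  field
    depth≤k  : depth forest ≤ k
    -- The `N` copies leave a choice of child when a colouring spoils some of them. Labels are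
    -- prescribed below `k` because proper ancestors have depth less than `k`.
    children : ∀ p (S : ℕ → Bool) → height p < k →
      Σ[ x ∈ (Fin N → Fin order) ] Injective _≡_ _≡_ x ×
        (∀ i → parent (x i) ≡ p × (∀ {j} → j < k → label (x i) j ≡ S j))

-- A vertex of the full M-ary forest with k levels is a nonempty word of length
-- at most k, coded as its last letter together with the position of the rest:
-- position zero is the empty word, position suc v is the word v.
module FullForest (M : ℕ) where

  size : ℕ → ℕ
  size zero    = 0
  size (suc k) = M * suc (size k)

  split : ∀ k → Fin (size (suc k)) → Fin M × Fin (suc (size k))
  split k = remQuot {M} (suc (size k))

  -- The same word read in the forest with one more level. The code of a word depends on the number
  -- of levels, so it is rebuilt letter by letter.
  raise : ∀ k → Fin (suc (size k)) → Fin (suc (size (suc k)))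
  raise _       zero    = zero
  raise (suc k) (suc i) = let a , q = split k i in suc (combine a (raise k q))

  level : ∀ k → Fin (suc (size k)) → ℕ
  level _       zero    = 0
  level (suc k) (suc i) = suc (level k (proj₂ (split k i)))

  letter : ∀ k → Fin (size k) → Fin M
  letter (suc k) i = proj₁ (split k i)

  parentPosition : ∀ k → Fin (size k) → Fin (suc (size k))
  parentPosition (suc k) i = raise k (proj₂ (split k i))

  split-combine : ∀ k a q → split k (combine a q) ≡ (a , q)
  split-combine k a q = Fin.remQuot-combine a q

  level≤ : ∀ k q → level k q ≤ k
  level≤ k       zero    = z≤n
  level≤ (suc k) (suc i) = s≤s (level≤ k _)

  level-raise : ∀ k q → level (suc k) (raise k q) ≡ level k q
  level-raise _       zero    = refl
  level-raise (suc k) (suc i) = cong suc (trans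
    (cong (level (suc k) ∘ proj₂) (split-combine (suc k) _ _))
    (level-raise k _))

  level-parent : ∀ k i → level k (suc i) ≡ suc (level k (parentPosition k i))
  level-parent (suc k) i = cong suc (sym (level-raise k _))

  lower : ∀ k q → level (suc k) q ≤ k → ∃[ q′ ] raise k q′ ≡ q
  lower k       zero    _ = zero , refl
  lower (suc k) (suc i) (s≤s l) with lower k (proj₂ (split (suc k) i)) l
  ... | q′ , eq = suc (combine (proj₁ (split (suc k) i)) q′) , cong suc
    (trans (cong (λ (a , q) → combine a (raise k q)) (split-combine k _ q′))
    (trans (cong (combine (proj₁ (split (suc k) i))) eq) (Fin.combine-remQuot {M} _ i)))

  -- A code with `k` levels stores the rest of its word with one level less. There is room for
  -- another letter since `q`, being shorter than `k`, comes from that smaller forest by `lower`.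
  extend : ∀ k a q → level k q < k →
    ∃[ i ] letter k i ≡ a × parentPosition k i ≡ q
  extend (suc k) a q (s≤s l) with lower k q l
  ... | q′ , eq = combine a q′ , cong proj₁ (split-combine k a q′) ,
    trans (cong (raise k ∘ proj₂) (split-combine k a q′)) eq

  parentOf : ∀ k → Fin (size k) → Maybe (Fin (size k))
  parentOf k = fromCode ∘ parentPosition k

  level⇒heightAtMost : ∀ k d {v} → level k (suc v) ≤ d → HeightAtMost (parentOf k) d v
  level⇒heightAtMost k zero    {v} l = contradiction (subst (_≤ 0) (level-parent k v) l) λ ()
  level⇒heightAtMost k (suc d) {v} l u e with parentPosition k v | level-parent k v
  level⇒heightAtMost k (suc d) {v} l u refl | suc .u | eq =
    level⇒heightAtMost k d (s≤s⁻¹ (subst (_≤ suc d) eq l))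

  heightAtMost : ∀ k v → HeightAtMost (parentOf k) k v
  heightAtMost k v = level⇒heightAtMost k k (level≤ k (suc v))

  fullForest : ∀ k → RootedForest (size k)
  fullForest k = boundedForest (parentOf k) (heightAtMost k)

  height-level : ∀ k d q → level k q ≤ d →
    ForestProperties.height (fullForest k) (fromCode q) ≡ level k q
  height-level k d       zero    _ = refl
  height-level k zero    (suc v) l = contradiction (subst (_≤ 0) (level-parent k v) l) λ ()
  height-level k (suc d) (suc v) l = trans (vertexDepth-parent v) (trans
    (cong suc (height-level k d _ (s≤s⁻¹ (subst (_≤ suc d) (level-parent k v) l))))
    (sym (level-parent k v)))
    where open ForestProperties (fullForest k)

universalForest : ∀ k N → UniversalForest k N
universalForest k N = record
  { order    = size k
  ; forest   = fullForest k
  ; label    = label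
  ; depth≤k  = boundedForest-depth (parentOf k) (heightAtMost k)
  ; children = children }
  where
  -- A letter encodes a label, as a binary word of length `k`, together with the number of one of
  -- `N` copies.
  open FullForest (2 ^ k * N)
  open RootedForest (fullForest k) using (parent)
  open ForestProperties (fullForest k)

  bits : Fin (size k) → Fin k → Fin 2
  bits v = finToFun (proj₁ (remQuot {2 ^ k} N (letter k v)))

  label : Fin (size k) → ℕ → Bool
  label v j with j ℕ.<? k
  ... | yes j<k = does (bits v (fromℕ< j<k) Fin.≟ suc zero)
  ... | no  _   = false

  bit : Bool → Fin 2
  bit b = if b then suc zero else zero

  bit-≟ : ∀ b → does (bit b Fin.≟ suc zero) ≡ b
  bit-≟ true  = refl
  bit-≟ false = refl

  label-bits : ∀ v S → bits v ≗ bit ∘ S ∘ toℕ → ∀ {j} → j < k → label v j ≡ S j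
  label-bits v S eq {j} j<k with j ℕ.<? k
  ... | no  j≮k = contradiction j<k j≮k
  ... | yes j<k = trans (cong (λ b → does (b Fin.≟ suc zero))
    (trans (eq _) (cong (bit ∘ S) (Fin.toℕ-fromℕ< j<k)))) (bit-≟ (S j))

  children : ∀ p (S : ℕ → Bool) → height p < k →
    Σ[ x ∈ (Fin N → Fin (size k)) ] Injective _≡_ _≡_ x ×
      (∀ i → parent (x i) ≡ p × (∀ {j} → j < k → label (x i) j ≡ S j))
  children p S h<k = proj₁ ∘ child , child-injective , λ i →
    trans (cong fromCode (proj₂ (proj₂ (child i)))) (fromCode-toCode p) ,
    label-bits _ S λ j → trans
      (cong (λ a → finToFun (proj₁ (remQuot {2 ^ k} N a)) j) (proj₁ (proj₂ (child i))))
      (trans (cong (λ a → finToFun (proj₁ a) j) (Fin.remQuot-combine word i))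
             (Fin.finToFun-funToFin {k} (bit ∘ S ∘ toℕ) j))
    where
    word : Fin (2 ^ k)
    word = funToFin {k} (bit ∘ S ∘ toℕ)

    level<k : level k (toCode p) < k
    level<k = subst (_< k) (trans (cong height (sym (fromCode-toCode p)))
      (height-level k k (toCode p) (level≤ k _))) h<k

    child : ∀ i → ∃[ v ] letter k v ≡ combine word i × parentPosition k v ≡ toCode p
    child i = extend k (combine word i) (toCode p) level<k

    child-injective : Injective _≡_ _≡_ (proj₁ ∘ child)
    child-injective {i} {j} eq = Fin.combine-injectiveʳ {2 ^ k} word i word j
      (trans (sym (proj₁ (proj₂ (child i)))) (trans (cong (letter k) eq) (proj₁ (proj₂ (child j)))))

open UniversalForest

-- Counting in decidable subsets.

does⇒ : {P : Set} (p? : Dec P) → does p? ≡ true → P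
does⇒ (yes p) _ = p

∈-tabulate⁺ : {P : Pred (Fin n) 0ℓ} (P? : Unary.Decidable P) → ∀ {v} →
  P v → v ∈ tabulate (does ∘ P?)
∈-tabulate⁺ P? {v} p =
  lookup⇒[]= v _ (trans (lookup∘tabulate (does ∘ P?) v) (dec-true (P? v) p))

∈-tabulate⁻ : {P : Pred (Fin n) 0ℓ} (P? : Unary.Decidable P) → ∀ {v} →
  v ∈ tabulate (does ∘ P?) → P v
∈-tabulate⁻ P? {v} v∈ =
  does⇒ (P? v) (trans (sym (lookup∘tabulate (does ∘ P?) v)) ([]=⇒lookup v∈))

-- Numbers the members of a subset from 0, so that a bound on its size becomes a supply of
-- pigeonholes.
rank : Subset n → Fin n → ℕ
rank (_       ∷ p) zero    = 0
rank (inside  ∷ p) (suc v) = suc (rank p v)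
rank (outside ∷ p) (suc v) = rank p v

rank< : ∀ {p : Subset n} {v} → v ∈ p → rank p v < ∣ p ∣
rank< {p = inside  ∷ p} here      = s≤s z≤n
rank< {p = inside  ∷ p} (there i) = s≤s (rank< i)
rank< {p = outside ∷ p} (there i) = rank< i

rank-injective : ∀ {p : Subset n} {v w} → v ∈ p → w ∈ p → rank p v ≡ rank p w → v ≡ w
rank-injective here here _ = refl
rank-injective {p = inside  ∷ p} (there i) (there j) eq =
  cong suc (rank-injective i j (ℕ.suc-injective eq))
rank-injective {p = outside ∷ p} (there i) (there j) eq = cong suc (rank-injective i j eq)

-- Allows finitely many propositions to be assumed decided at once when the goal is `⊥`.
¬¬-∀ : {P : Pred (Fin n) 0ℓ} → (∀ i → ¬ ¬ P i) → ¬ ¬ (∀ i → P i)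
¬¬-∀ = Fin.sequence (RawMonad.rawApplicative ¬¬-Monad)

-- Embedding a graph so as to avoid monochromatic edges.

universalGraph : ∀ {k N} (U : UniversalForest k N) → Graph (order U)
universalGraph U = LabelledForest.labelledGraph (forest U) (label U)

map-just⁻ : ∀ {g : A → B} {y} x → Maybe.map g x ≡ just y → ∃[ u ] x ≡ just u × g u ≡ y
map-just⁻ (just u) eq = u , refl , just-injective eq

module Embedding {k d : ℕ} (U : UniversalForest k (suc (k * d)))
  (f : Colouring (order U) c) (hasDefect : HasDefect (universalGraph U) f d) where

  open LabelledForest (forest U) (label U) using (_↝_; Edge; edge?)
  module 𝐔 where
    open RootedForest (forest U) hiding (depth; closure) public
    open ForestProperties (forest U) public
  H = universalGraph U

  vertexDepth≤k : ∀ v → 𝐔.vertexDepth v ≤ k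
  vertexDepth≤k v = ℕ.≤-trans (𝐔.vertexDepth≤depth v) (depth≤k U)

  Reachable : Fin (order U) → Fin (order U) → Set
  Reachable y = Star (InducedAdj H (colourClass f (f y))) y

  ∈-colourClass : ∀ {i v} → f v ≡ i → v ∈ colourClass f i
  ∈-colourClass {i} = ∈-tabulate⁺ (λ v → f v Fin.≟ i)

  -- Each conflicting child is a monochromatic neighbour of one of at most k
  -- proper ancestors, shared with its siblings, each having at most d such
  -- neighbours, so the k * d + 1 siblings cannot all be in conflict. Deciding
  -- reachability is harmless since a contradiction is sought.
  siblingsNotAllInConflict : (x : Fin (suc (k * d)) → Fin (order U)) → Injective _≡_ _≡_ x →
    (∀ i j → 𝐔.parent (x i) ≡ 𝐔.parent (x j)) →
    ¬ (∀ i → ∃[ y ] Edge (x i) y × f (x i) ≡ f y)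
  siblingsNotAllInConflict x x-inj siblings conflict =
    ¬¬-∀ (λ y → ¬¬-∀ λ w → ¬¬-excluded-middle) clash
    where
    y : Fin (suc (k * d)) → Fin (order U)
    y i = proj₁ (conflict i)

    edge : ∀ i → Edge (x i) (y i)
    edge i = proj₁ (proj₂ (conflict i))

    sameColour : ∀ i → f (x i) ≡ f (y i)
    sameColour i = proj₂ (proj₂ (conflict i))

    module _ (reachable? : ∀ y w → Dec (Reachable y w)) where
      component : Fin (order U) → Subset (order U)
      component y = tabulate (does ∘ reachable? y)

      monochromatic : ∀ y → IsMonochromaticComponent H f (component y)
      monochromatic y = f y , y , ∈-colourClass refl , λ w →
        mk⇔ (∈-tabulate⁻ (reachable? y)) (∈-tabulate⁺ (reachable? y))

      crowd : Fin (order U) → Subset (order U)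
      crowd y = neighbours H y ∩ component y

      x∈crowd : ∀ i → x i ∈ crowd (y i)
      x∈crowd i = x∈p∩q⁺
        ( ∈-tabulate⁺ (adj? H (y i)) (inj₂ (edge i))
        , ∈-tabulate⁺ (reachable? (y i))
            ((∈-colourClass refl , ∈-colourClass (sameColour i) , inj₂ (edge i)) ◅ ε) )

      depth<k : ∀ i → 𝐔.vertexDepth (y i) < k
      depth<k i = let (p , y≢x , _) , _ = edge i in
        ℕ.≤-trans (𝐔.properAncestor-depth p y≢x) (vertexDepth≤k _)

      rank<d : ∀ i → rank (crowd (y i)) (x i) < d
      rank<d i = ℕ.≤-trans (rank< (x∈crowd i))
        (hasDefect _ (monochromatic (y i)) (y i) (∈-tabulate⁺ (reachable? (y i)) ε))

      -- Siblings share their proper ancestors, so the first coordinate, a depth, determines the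
      -- ancestor in conflict; the second then determines the child among the monochromatic
      -- neighbours of that ancestor.
      hole : Fin (suc (k * d)) → Fin (k * d)
      hole i = combine (fromℕ< (depth<k i)) (fromℕ< (rank<d i))

      y-ancestor : ∀ i j → y i 𝐔.IsAncestorOf x j
      y-ancestor i j =
        let (p , y≢x , _) , _ = edge i
            w , e , q = 𝐔.properAncestor-parent p y≢x
        in trans (siblings j i) e ◅ q

      clash : ⊥
      clash with Fin.pigeonhole ℕ.≤-refl hole
      ... | i , j , i<j , eq with Fin.combine-injective (fromℕ< (depth<k i)) _ _ _ eq
      ...   | depths , ranks = Fin.<⇒≢ i<j (x-inj (rank-injective
              (x∈crowd i) (subst (λ z → x j ∈ crowd z) (sym y-eq) (x∈crowd j))
              (trans (Fin.fromℕ<-injective _ _ (rank<d i) (rank<d j) ranks)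
                     (cong (λ z → rank (crowd z) (x j)) (sym y-eq)))))
        where
        y-eq : y i ≡ y j
        y-eq = 𝐔.ancestor-unique (y-ancestor i i) (y-ancestor j i)
          (Fin.fromℕ<-injective _ _ (depth<k i) (depth<k j) depths)

  Conflictless : Pred (Fin (order U)) 0ℓ
  Conflictless x = ∀ y → Edge x y → f x ≢ f y

  opaque
    -- The search through the copies is decidable, so refuting that all are in conflict produces an
    -- actual child.
    conflictlessChild : ∀ p (S : ℕ → Bool) → 𝐔.height p < k →
      ∃[ x ] 𝐔.parent x ≡ p × (∀ {j} → j < k → label U x j ≡ S j) × Conflictless x
    conflictlessChild p S h<k with children U p S h<k
    ... | x , x-inj , spec
      with any? (λ i → all? λ y → edge? (x i) y →-dec ¬? (f (x i) Fin.≟ f y))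
    ...   | yes (i , ok) = x i , proj₁ (spec i) , proj₂ (spec i) , ok
    ...   | no  none = contradiction conflict
            (siblingsNotAllInConflict x x-inj λ i j → trans (proj₁ (spec i)) (sym (proj₁ (spec j))))
      where
      conflict : ∀ i → ∃[ y ] Edge (x i) y × f (x i) ≡ f y
      conflict i = decidable-stable (any? λ y → edge? (x i) y ×-dec (f (x i) Fin.≟ f y))
        λ ¬y → none (i , λ y e eq → ¬y (y , e , eq))

  module _ {m : ℕ} (G : Graph m) (triangleFree : TriangleFree G)
    (F : RootedForest m) (depth≤ : depth F ≤ k) (spans : G IsSpanningSubgraphOf closure F) where

    open RootedForest F hiding (depth; closure)
    open ForestProperties F hiding (depth≤)

    AdjacentAncestorAt : Fin m → ℕ → Fin m → Set
    AdjacentAncestorAt v j u = u IsAncestorOf v × vertexDepth u ≡ j × Adj G v u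

    opaque
      adjacentAncestorAt? : ∀ v j → Unary.Decidable (AdjacentAncestorAt v j)
      adjacentAncestorAt? v j u = ancestor? u v ×-dec vertexDepth u ℕ.≟ j ×-dec adj? G v u

    ancestry : Fin m → ℕ → Bool
    ancestry v j = does (any? (adjacentAncestorAt? v j))

    ancestry⇒adj : ∀ {u v} → u IsAncestorOf v → ancestry v (vertexDepth u) ≡ true → Adj G v u
    ancestry⇒adj {u} {v} p t with does⇒ (any? (adjacentAncestorAt? v (vertexDepth u))) t
    ... | u′ , p′ , eq , a = subst (Adj G v) (ancestor-unique p′ p eq) a

    adj⇒ancestry : ∀ {u v} → u IsAncestorOf v → Adj G v u → ancestry v (vertexDepth u) ≡ true
    adj⇒ancestry {u} {v} p a =
      dec-true (any? (adjacentAncestorAt? v (vertexDepth u))) (u , p , refl , a)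

    -- The equality of depths is part of the invariant because it guarantees a level for the next
    -- child.
    Placed : Fin m → (Fin m → Fin (order U)) → Fin (order U) → Set
    Placed v g x = 𝐔.parent x ≡ Maybe.map g (parent v) × 𝐔.vertexDepth x ≡ vertexDepth v ×
      (∀ {j} → j < k → label U x j ≡ ancestry v j) × Conflictless x

    vertexDepth≤ : ∀ v → vertexDepth v ≤ k
    vertexDepth≤ v = ℕ.≤-trans (vertexDepth≤depth v) depth≤

    placed-local : ∀ {v g g′ x} → (∀ {u} → u IsAncestorOf v → u ≢ v → g u ≡ g′ u) →
      Placed v g x → Placed v g′ x
    placed-local {v} {g} {g′} eq (par , rest) = trans par (agree refl) , rest
      where
      agree : ∀ {p} → parent v ≡ p → Maybe.map g p ≡ Maybe.map g′ p
      agree {nothing} _ = refl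
      agree {just u}  e = let p , u≢v = parent-properAncestor e ε in cong just (eq p u≢v)

    AncestorsPlaced : Fin m → (Fin m → Fin (order U)) → Set
    AncestorsPlaced v g = ∀ {u} → u IsAncestorOf v → u ≢ v → Placed u g (g u)

    placed-height : ∀ {v g} → AncestorsPlaced v g →
      suc (𝐔.height (Maybe.map g (parent v))) ≡ vertexDepth v
    placed-height {v} {g} placed = trans (cong suc (heights refl)) (sym (vertexDepth-parent v))
      where
      heights : ∀ {p} → parent v ≡ p → 𝐔.height (Maybe.map g p) ≡ height p
      heights {nothing} _ = refl
      heights {just u}  e = let p , u≢v = parent-properAncestor e ε in
        proj₁ (proj₂ (placed p u≢v))

    place : ∀ v g → AncestorsPlaced v g → ∃ (Placed v g)
    place v g placed =
      let x , par , lab , ok = conflictlessChild (Maybe.map g (parent v)) (ancestry v)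
            (subst (_≤ k) (sym (placed-height placed)) (vertexDepth≤ v))
      in x , par ,
         trans (𝐔.vertexDepth-parent x)
           (trans (cong (suc ∘ 𝐔.height) par) (placed-height placed)) ,
         lab , ok

    opaque
      embedding : ∃[ g ] ∀ v → Placed v g (g v)
      embedding = forestRec
        -- As `v` exists, `k` is at least 1, so a root is available as placeholder.
        (λ v → proj₁ (conflictlessChild nothing (ancestry v)
          (ℕ.≤-trans (s≤s z≤n) (subst (_≤ k) (vertexDepth-parent v) (vertexDepth≤ v)))))
        Placed placed-local place

    g = proj₁ embedding
    placed = proj₂ embedding

    g-parent : ∀ {u v} → u IsParentOf v → g u 𝐔.IsParentOf g v
    g-parent {v = v} e = trans (proj₁ (placed v)) (cong (Maybe.map g) e)

    g-ancestor : ∀ {u v} → u IsAncestorOf v → g u 𝐔.IsAncestorOf g v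
    g-ancestor = Star.gmap g g-parent

    g-depth : ∀ v → 𝐔.vertexDepth (g v) ≡ vertexDepth v
    g-depth v = proj₁ (proj₂ (placed v))

    g-parent⁻ : ∀ {v y} → y 𝐔.IsParentOf g v → ∃[ u ] u IsParentOf v × g u ≡ y
    g-parent⁻ {v} e = map-just⁻ (parent v) (trans (sym (proj₁ (placed v))) e)

    -- `g` commutes with taking parents, and roots go to roots; hence the path from `g v` towards
    -- the root lifts step by step.
    g-ancestor⁻ : ∀ {v x y} → y 𝐔.IsAncestorOf x → g v ≡ x → ∃[ u ] u IsAncestorOf v × g u ≡ y
    g-ancestor⁻ {v} ε       eq   = v , ε , eq
    g-ancestor⁻ {v} (e ◅ p) refl =
      let w , e′ , gw = g-parent⁻ e
          u , q , gu = g-ancestor⁻ p gw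
      in u , e′ ◅ q , gu

    label-g : ∀ {u v} → u IsAncestorOf v → u ≢ v →
      label U (g v) (𝐔.vertexDepth (g u)) ≡ ancestry v (vertexDepth u)
    label-g {u} {v} p u≢v = trans (cong (label U (g v)) (g-depth u))
      (proj₁ (proj₂ (proj₂ (placed v)))
        (ℕ.≤-trans (properAncestor-depth p u≢v) (vertexDepth≤ v)))

    ↝⇒adj : ∀ {v y} → g v ↝ y → ∃[ u ] u IsAncestorOf v × g u ≡ y × Adj G v u
    ↝⇒adj {v} (p , y≢ , t) with g-ancestor⁻ p refl
    ... | u , q , refl = u , q , refl ,
      ancestry⇒adj q (trans (sym (label-g q (y≢ ∘ cong g))) t)

    -- A violation at `g v` lifts to a triangle of `G`, so no edge of `G` is lost to the
    -- admissibility condition.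
    admissible : ∀ v → LabelledForest.Admissible (forest U) (label U) (g v)
    admissible v y z vy vz yz with ↝⇒adj vy
    ... | u , p , refl , a with ↝⇒adj vz | ↝⇒adj yz
    ...   | w , q , refl , b | w′ , q′ , eq , c =
      triangleFree v u w a (subst (Adj G u) w′≡w c) (symmetric G b)
      where
      -- `g` need not be injective, but both lifts are ancestors of `v` at the same depth.
      w′≡w : w′ ≡ w
      w′≡w = ancestor-unique (p ◅◅ q′) q
        (trans (sym (g-depth w′)) (trans (cong 𝐔.vertexDepth eq) (g-depth w)))

    g-edge : ∀ {u v} → u IsAncestorOf v → u ≢ v → Adj G v u → Edge (g v) (g u)
    g-edge {u} {v} p u≢v a =
      (g-ancestor p , gu≢gv , trans (label-g p u≢v) (adj⇒ancestry p a)) , admissible v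
      where
      gu≢gv : g u ≢ g v
      gu≢gv eq = ℕ.<⇒≢ (properAncestor-depth p u≢v)
        (trans (sym (g-depth u)) (trans (cong 𝐔.vertexDepth eq) (g-depth v)))

    conflictless : ∀ v → Conflictless (g v)
    conflictless v = proj₂ (proj₂ (proj₂ (placed v)))

    -- An edge of `G` joins an ancestor to a descendant and is mapped to an `Edge`, whose lower end
    -- was chosen free of conflicts.
    properColouring : Σ[ h ∈ Colouring m c ] IsProper G h
    properColouring = f ∘ g , λ u v a → case u v a (spans u v a)
      where
      case : ∀ u v → Adj G u v → Adj (closure F) u v → f (g u) ≢ f (g v)
      case u v a (u≢v , inj₁ p) eq =
        conflictless v (g u) (g-edge p u≢v (symmetric G a)) (sym eq)
      case u v a (u≢v , inj₂ p) eq =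
        conflictless u (g v) (g-edge p (u≢v ∘ sym) a) eq

-- Comparing proper, clustered and defective colourings.

-- The first step of a nontrivial path inside a component would be a monochromatic edge, so
-- components are single vertices.
proper⇒clustering : (G : Graph n) (f : Colouring n c) → IsProper G f → HasClustering G f 1
proper⇒clustering G f proper C (i , v , _ , reach) =
  subst (∣ C ∣ ≤_) (∣⁅x⁆∣≡1 v) (p⊆q⇒∣p∣≤∣q∣ λ {w} w∈C → only (Equivalence.to (reach w) w∈C))
  where
  colour : ∀ {u} → u ∈ colourClass f i → f u ≡ i
  colour = ∈-tabulate⁻ (λ u → f u Fin.≟ i)

  only : ∀ {w} → Star (InducedAdj G (colourClass f i)) v w → w ∈ ⁅ v ⁆
  only ε = x∈⁅x⁆ v
  only ((v∈ , u∈ , a) ◅ _) = contradiction (trans (colour v∈) (sym (colour u∈))) (proper _ _ a)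

clustering⇒defect : ∀ {s} (G : Graph n) (f : Colouring n c) → HasClustering G f s → HasDefect G f s
clustering⇒defect G f clustered C mono v _ =
  ℕ.≤-trans (p⊆q⇒∣p∣≤∣q∣ (p∩q⊆q (neighbours G v) C)) (clustered C mono)

-- Upper bound by first-fit colouring.

module FirstFit {m : ℕ} (G : Graph m) (triangleFree : TriangleFree G)
  (F : RootedForest m) (spans : G IsSpanningSubgraphOf closure F) where

  open RootedForest F hiding (depth; closure)
  open ForestProperties F

  Blocks : Fin m → (Fin m → ℕ) → ℕ → Fin m → Set
  Blocks v g j u = u IsAncestorOf v × Adj G u v × g u ≡ j

  Blocked : Fin m → (Fin m → ℕ) → Pred ℕ 0ℓ
  Blocked v g j = ∃ (Blocks v g j)

  opaque
    blocked? : ∀ v g → Unary.Decidable (Blocked v g)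
    blocked? v g j = any? λ u → ancestor? u v ×-dec adj? G u v ×-dec g u ℕ.≟ j

  IsFirstFit : Fin m → (Fin m → ℕ) → Pred ℕ 0ℓ
  IsFirstFit v g = IsMinimum λ j → ¬ Blocked v g j

  -- Among `m + 1` colours the `m` vertices cannot block all; this crude bound only serves to start
  -- the search for the least free colour.
  someColourFree : ∀ v g → ∃[ i ] ¬ Blocked v g (toℕ {suc m} i)
  someColourFree v g = decidable-stable (any? λ i → ¬? (blocked? v g (toℕ i))) λ none →
    let blocked i = decidable-stable (blocked? v g (toℕ i)) (none ∘ (i ,_))
        i , j , i<j , eq = Fin.pigeonhole ℕ.≤-refl (proj₁ ∘ blocked)
    in Fin.<⇒≢ i<j (Fin.toℕ-injective
         (trans (sym (proj₂ (proj₂ (proj₂ (blocked i)))))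
         (trans (cong g eq) (proj₂ (proj₂ (proj₂ (blocked j)))))))

  opaque
    firstFit : ∃[ g ] ∀ v → IsFirstFit v g (g v)
    firstFit = forestRec (λ _ → 0) IsFirstFit local λ v g _ →
      least (¬? ∘ blocked? v g) (proj₂ (someColourFree v g))
      where
      move : ∀ {v g g′ j} → (∀ {u} → u IsAncestorOf v → u ≢ v → g u ≡ g′ u) →
        Blocked v g j → Blocked v g′ j
      move eq (u , p , a , gu) = u , p , a ,
        trans (sym (eq p λ { refl → irrefl G _ a })) gu

      local : ∀ {v g g′ j} → (∀ {u} → u IsAncestorOf v → u ≢ v → g u ≡ g′ u) →
        IsFirstFit v g j → IsFirstFit v g′ j
      local eq (free , min) = free ∘ move (λ p u≢v → sym (eq p u≢v)) ,
        λ i free′ → min i (free′ ∘ move eq)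

  g : Fin m → ℕ
  g = proj₁ firstFit

  blocked : ∀ v {j} → j < g v → Blocked v g j
  blocked v {j} j<gv = decidable-stable (blocked? v g j) λ free →
    ℕ.<⇒≱ j<gv (proj₂ (proj₂ firstFit v) j free)

  g-proper : ∀ u v → Adj G u v → g u ≢ g v
  g-proper u v a eq with spans u v a
  ... | _ , inj₁ p = proj₁ (proj₂ firstFit v) (u , p , a , eq)
  ... | _ , inj₂ p = proj₁ (proj₂ firstFit u) (v , p , symmetric G a , sym eq)

  -- The neighbours a j of v blocking the colours below g v are disjoint from
  -- the neighbours b j (among them v itself) of the last of them, w.
  module _ (v : Fin m) {l : ℕ} (gv≡ : g v ≡ suc l) where

    a-blocks : ∀ (j : Fin (suc l)) → Blocked v g (toℕ j)
    a-blocks j = blocked v (subst (toℕ j <_) (sym gv≡) (Fin.toℕ<n j))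

    w-blocks : Blocked v g l
    w-blocks = blocked v (subst (l <_) (sym gv≡) ℕ.≤-refl)

    a : Fin (suc l) → Fin m
    a = proj₁ ∘ a-blocks

    w : Fin m
    w = proj₁ w-blocks

    w-ancestor : w IsAncestorOf v
    w-ancestor = proj₁ (proj₂ w-blocks)

    w-adj : Adj G w v
    w-adj = proj₁ (proj₂ (proj₂ w-blocks))

    gw≡l : g w ≡ l
    gw≡l = proj₂ (proj₂ (proj₂ w-blocks))

    b-vertex : ∀ (j : Fin (suc l)) → ∃[ u ] u IsAncestorOf v × Adj G u w ×
      ((toℕ j < l × g u ≡ toℕ j) ⊎ (toℕ j ≡ l × g u ≡ suc l))
    b-vertex j with toℕ j ℕ.<? l
    ... | yes j<l = let u , p , e , gu = blocked w (subst (toℕ j <_) (sym gw≡l) j<l) in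
      u , w-ancestor ◅◅ p , e , inj₁ (j<l , gu)
    -- Here `j` equals `l`, the colour of `w` itself; `v`, coloured `suc l`, takes the place of a
    -- neighbour of that colour.
    ... | no  j≮l = v , ε , symmetric G w-adj ,
      inj₂ (ℕ.≤-antisym (s≤s⁻¹ (Fin.toℕ<n j)) (ℕ.≮⇒≥ j≮l) , gv≡)

    b : Fin (suc l) → Fin m
    b = proj₁ ∘ b-vertex

    a-injective : Injective _≡_ _≡_ a
    a-injective {i} {j} eq = Fin.toℕ-injective (trans (sym (proj₂ (proj₂ (proj₂ (a-blocks i)))))
      (trans (cong g eq) (proj₂ (proj₂ (proj₂ (a-blocks j))))))

    b-injective : Injective _≡_ _≡_ b
    b-injective {i} {j} eq with proj₂ (proj₂ (proj₂ (b-vertex i))) | proj₂ (proj₂ (proj₂ (b-vertex j)))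
    ... | inj₁ (_ , x) | inj₁ (_ , y) = Fin.toℕ-injective (trans (sym x) (trans (cong g eq) y))
    ... | inj₂ (x , _) | inj₂ (y , _) = Fin.toℕ-injective (trans x (sym y))
    ... | inj₁ (i<l , x) | inj₂ (_ , y) = contradiction (trans (sym x) (trans (cong g eq) y))
      (ℕ.<⇒≢ (ℕ.m≤n⇒m≤1+n i<l))
    ... | inj₂ (_ , x) | inj₁ (j<l , y) = contradiction (trans (sym y) (trans (cong g (sym eq)) x))
      (ℕ.<⇒≢ (ℕ.m≤n⇒m≤1+n j<l))

    -- A common vertex would be adjacent to both ends of the edge between `v` and `w`.
    a≢b : ∀ i j → a i ≢ b j
    a≢b i j eq = triangleFree (a i) v w (proj₁ (proj₂ (proj₂ (a-blocks i)))) (symmetric G w-adj)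
      (symmetric G (subst (λ u → Adj G u w) (sym eq) (proj₁ (proj₂ (proj₂ (b-vertex j))))))

    ab : Fin (suc l) ⊎ Fin (suc l) → Fin m
    ab = Sum.[ a , b ]

    ab-injective : ∀ x y → ab x ≡ ab y → x ≡ y
    ab-injective (inj₁ i) (inj₁ j) eq = cong inj₁ (a-injective eq)
    ab-injective (inj₁ i) (inj₂ j) eq = contradiction eq (a≢b i j)
    ab-injective (inj₂ i) (inj₁ j) eq = contradiction (sym eq) (a≢b j i)
    ab-injective (inj₂ i) (inj₂ j) eq = cong inj₂ (b-injective eq)

    ab-ancestor : ∀ x → ab x IsAncestorOf v
    ab-ancestor (inj₁ i) = proj₁ (proj₂ (a-blocks i))
    ab-ancestor (inj₂ j) = proj₁ (proj₂ (b-vertex j))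

    -- Depths start at 1, so depth minus one, the height of the parent, indexes the ancestors of
    -- `v`.
    position : Fin (suc l + suc l) → Fin (vertexDepth v)
    position i = fromℕ< (subst (_≤ vertexDepth v) (vertexDepth-parent (ab (splitAt (suc l) i)))
      (ancestor-depth (ab-ancestor (splitAt (suc l) i))))

    position-injective : Injective _≡_ _≡_ position
    position-injective {i} {j} eq = trans (sym (Fin.join-splitAt (suc l) (suc l) i)) (trans
      (cong (join (suc l) (suc l)) (ab-injective x y
        (ancestor-unique (ab-ancestor x) (ab-ancestor y) depth≡)))
      (Fin.join-splitAt (suc l) (suc l) j))
      where
      x = splitAt (suc l) i
      y = splitAt (suc l) j
      depth≡ : vertexDepth (ab x) ≡ vertexDepth (ab y)
      depth≡ = trans (vertexDepth-parent (ab x)) (trans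
        (cong suc (Fin.fromℕ<-injective _ _ _ _ eq)) (sym (vertexDepth-parent (ab y))))

    doubled≤vertexDepth : suc l + suc l ≤ vertexDepth v
    doubled≤vertexDepth = Fin.injective⇒≤ position-injective

  doubledColour≤depth : ∀ v → g v + g v ≤ depth F
  doubledColour≤depth v with g v in eq
  ... | zero  = z≤n
  ... | suc l = ℕ.≤-trans (doubled≤vertexDepth v eq) (vertexDepth≤depth v)

  firstFitColouring : ∀ {k} → depth F ≤ k → Σ[ f ∈ Colouring m ⌈ k + 2 /2⌉ ] IsProper G f
  firstFitColouring {k} D≤k = (λ v → fromℕ< (g< v)) , λ u v e eq →
    g-proper u v e (Fin.fromℕ<-injective _ _ (g< u) (g< v) eq)
    where
    g< : ∀ v → g v < ⌈ k + 2 /2⌉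
    -- The right-hand side unfolds to one more than `⌊ suc k /2⌋`, and `g v` is rewritten as half of
    -- `g v + g v`.
    g< v rewrite ℕ.+-comm k 2 | ℕ.n≡⌊n+n/2⌋ (g v) =
      s≤s (ℕ.⌊n/2⌋-mono (ℕ.m≤n⇒m≤1+n (ℕ.≤-trans (doubledColour≤depth v) D≤k)))

-- Triangular numbers and the vanishing error term.

triangular : ℕ → ℕ
triangular zero    = 0
triangular (suc m) = triangular m + suc m

triangular-mono : ∀ {m n} → m ≤ n → triangular m ≤ triangular n
triangular-mono z≤n     = z≤n
triangular-mono (s≤s p) = ℕ.+-mono-≤ (triangular-mono p) (s≤s p)

2*triangular : ∀ m → 2 * triangular m ≡ m * suc m
2*triangular zero    = refl
2*triangular (suc m) = trans (ℕ.*-distribˡ-+ 2 (triangular m) (suc m))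
  (trans (cong (_+ 2 * suc m) (2*triangular m)) (identity m))
  where
  identity : ∀ m → m * suc m + 2 * suc m ≡ suc m * suc (suc m)
  identity = ℕRing.solve-∀

triangularRoot : ∀ k → ∃[ m ] triangular m ≤ k × k < triangular (suc m)
triangularRoot zero    = 0 , z≤n , s≤s z≤n
triangularRoot (suc k) with triangularRoot k
... | m , t≤k , k<t with suc k ℕ.<? triangular (suc m)
...   | yes sk<t = m , ℕ.m≤n⇒m≤1+n t≤k , sk<t
...   | no  sk≮t = suc m , ℕ.≮⇒≥ sk≮t ,
        ℕ.≤-<-trans k<t (ℕ.m<m+n (triangular (suc m)) (s≤s z≤n))

root : ℕ → ℕ
root = proj₁ ∘ triangularRoot

≤root : ∀ {m k} → triangular m ≤ k → m ≤ root k
≤root {m} {k} t≤k = ℕ.≮⇒≥ λ root<m →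
  ℕ.<⇒≱ (proj₂ (proj₂ (triangularRoot k))) (ℕ.≤-trans (triangular-mono root<m) t≤k)

-- By maximality of the root, `k` is below the next triangular number. Thus `root k` falls short of
-- the square root of `2 * k` by at most 2.
2*k≤ : ∀ k → 2 * k ≤ (2 + root k) * (2 + root k)
2*k≤ k = begin
  2 * k                           ≤⟨ ℕ.*-monoʳ-≤ 2 (ℕ.<⇒≤ (proj₂ (proj₂ (triangularRoot k)))) ⟩
  2 * triangular (suc (root k))   ≡⟨ 2*triangular (suc (root k)) ⟩
  suc (root k) * (2 + root k)     ≤⟨ ℕ.*-monoˡ-≤ (2 + root k) (ℕ.n≤1+n (suc (root k))) ⟩
  (2 + root k) * (2 + root k)     ∎
  where open ℕ.≤-Reasoning

fromℕ-mono : ∀ {m n} → m ≤ n → fromℕ m ℚ.≤ fromℕ n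
fromℕ-mono {m} {n} m≤n = ℚ.toℚᵘ-cancel-≤ (ℚᵘ.≤-respˡ-≃ (ℚᵘ.≃-sym (ℚ.toℚᵘ-fromℚᵘ (mkℚᵘ (+ m) 0)))
  (ℚᵘ.≤-respʳ-≃ (ℚᵘ.≃-sym (ℚ.toℚᵘ-fromℚᵘ (mkℚᵘ (+ n) 0)))
    (*≤* (ℤ.*-monoʳ-≤-nonNeg (+ 1) (+≤+ m≤n)))))

fromℕ-* : ∀ m n → fromℕ (m * n) ≡ fromℕ m ℚ.* fromℕ n
fromℕ-* m n = ℚ.toℚᵘ-injective (begin
  toℚᵘ (fromℕ (m * n))                ≈⟨ ℚ.toℚᵘ-fromℚᵘ (mkℚᵘ (+ (m * n)) 0) ⟩
  mkℚᵘ (+ (m * n)) 0                  ≈⟨ *≡* (cong (ℤ._* + 1) (ℤ.pos-* m n)) ⟩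
  mkℚᵘ (+ m) 0 ℚᵘ.* mkℚᵘ (+ n) 0      ≈⟨ ℚᵘ.*-cong (ℚ.toℚᵘ-fromℚᵘ (mkℚᵘ (+ m) 0)) (ℚ.toℚᵘ-fromℚᵘ (mkℚᵘ (+ n) 0)) ⟨
  toℚᵘ (fromℕ m) ℚᵘ.* toℚᵘ (fromℕ n)  ≈⟨ ℚ.toℚᵘ-homo-* (fromℕ m) (fromℕ n) ⟨
  toℚᵘ (fromℕ m ℚ.* fromℕ n)          ∎)
  where open ℚᵘ.≃-Reasoning

-- Chosen so that `1 - deviation m` is the ratio of `m` to `m + 2`; for `m` equal to `root k` these
-- are the lower bound on the colours and an upper bound on the square root of `2 * k`.
deviation : ℕ → ℚ
deviation m = + 2 ℚ./ suc (suc m)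

deviation-scaled : ∀ m → (1ℚ - deviation m) ℚ.* fromℕ (2 + m) ≡ fromℕ m
deviation-scaled m = ℚ.toℚᵘ-injective (begin
  toℚᵘ ((1ℚ - o) ℚ.* s)                    ≈⟨ ℚ.toℚᵘ-homo-* (1ℚ - o) s ⟩
  toℚᵘ (1ℚ - o) ℚᵘ.* toℚᵘ s                ≈⟨ ℚᵘ.*-cong 1-o (ℚ.toℚᵘ-fromℚᵘ (mkℚᵘ (+ (2 + m)) 0)) ⟩
  (mkℚᵘ (+ 1) 0 ℚᵘ.- mkℚᵘ (+ 2) (suc m)) ℚᵘ.* mkℚᵘ (+ (2 + m)) 0
    ≈⟨ *≡* (identity (+ m)) ⟩
  mkℚᵘ (+ m) 0                             ≈⟨ ℚ.toℚᵘ-fromℚᵘ (mkℚᵘ (+ m) 0) ⟨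
  toℚᵘ (fromℕ m)                           ∎)
  where
  open ℚᵘ.≃-Reasoning
  o = deviation m
  s = fromℕ (2 + m)

  1-o : toℚᵘ (1ℚ - o) ℚᵘ.≃ mkℚᵘ (+ 1) 0 ℚᵘ.- mkℚᵘ (+ 2) (suc m)
  1-o = ℚᵘ.≃-trans (ℚ.toℚᵘ-homo-+ 1ℚ (ℚ.- o)) (ℚᵘ.+-congʳ (mkℚᵘ (+ 1) 0)
    (ℚᵘ.≃-trans (ℚ.toℚᵘ-homo‿- o) (ℚᵘ.-‿cong (ℚ.toℚᵘ-fromℚᵘ (mkℚᵘ (+ 2) (suc m))))))

  identity : ∀ x → ((+ 1 ℤ.* (+ 2 ℤ.+ x) ℤ.+ ℤ.- (+ 2) ℤ.* + 1) ℤ.* (+ 2 ℤ.+ x)) ℤ.* + 1 ≡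
    x ℤ.* (+ 1 ℤ.* (+ 2 ℤ.+ x) ℤ.* + 1)
  identity = ℤRing.solve-∀

deviation→0 : TendsToZero (deviation ∘ root)
-- The target is `suc a / suc d`. From this threshold on, `root k` is at least `2 * suc d`, which
-- makes the deviation less than `1 / suc d`.
deviation→0 (mkℚ (+ suc a) d cop) (ℚ.*<* _) = triangular (2 * suc d) , bound
  where
  bound : ∀ k → k ≥ triangular (2 * suc d) →
    ℚ.∣ deviation (root k) ∣ ℚ.< mkℚ (+ suc a) d cop
  bound k k≥ = subst (ℚ._< mkℚ (+ suc a) d cop)
    (sym (ℚ.0≤p⇒∣p∣≡p (ℚ.nonNegative⁻¹ _ {{ℚ.normalize-nonNeg 2 (2 + root k)}})))
    (ℚ.toℚᵘ-cancel-< (ℚᵘ.<-respˡ-≃ (ℚᵘ.≃-sym (ℚ.toℚᵘ-fromℚᵘ (mkℚᵘ (+ 2) (suc (root k)))))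
      (*<* (subst₂ ℤ._<_ (ℤ.pos-* 2 (suc d)) (ℤ.pos-* (suc a) (2 + root k)) (+<+ small)))))
    where
    open ℕ.≤-Reasoning
    small : 2 * suc d < suc a * (2 + root k)
    small = begin-strict
      2 * suc d               ≤⟨ ≤root k≥ ⟩
      root k                  <⟨ ℕ.m≤n+m (suc (root k)) 1 ⟩
      2 + root k              ≤⟨ ℕ.m≤n*m (2 + root k) (suc a) ⟩
      suc a * (2 + root k)    ∎
deviation→0 (mkℚ (+ zero) d cop) (ℚ.*<* (+<+ ()))

-- Replacing `2 * k` by the square of `2 + root k` makes the left side exactly the square of
-- `root k`.
deviation-√ : ∀ k χ → root k ≤ χ → (1ℚ - deviation (root k)) ·√ (2 * k) ≤ χ
deviation-√ k χ m≤χ 0≤a = begin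
  a ℚ.* a ℚ.* fromℕ (2 * k)      ≤⟨ ℚ.*-monoˡ-≤-nonNeg (a ℚ.* a) {{a²≥0}} (fromℕ-mono (2*k≤ k)) ⟩
  a ℚ.* a ℚ.* fromℕ (s * s)      ≡⟨ cong (a ℚ.* a ℚ.*_) (fromℕ-* s s) ⟩
  a ℚ.* a ℚ.* (fromℕ s ℚ.* fromℕ s)      ≡⟨ interchange (CommutativeMonoid.commutativeSemigroup ℚ.*-1-commutativeMonoid) a a (fromℕ s) (fromℕ s) ⟩
  (a ℚ.* fromℕ s) ℚ.* (a ℚ.* fromℕ s)    ≡⟨ cong₂ ℚ._*_ (deviation-scaled r) (deviation-scaled r) ⟩
  fromℕ r ℚ.* fromℕ r           ≡⟨ fromℕ-* r r ⟨
  fromℕ (r * r)                 ≤⟨ fromℕ-mono (ℕ.*-mono-≤ m≤χ m≤χ) ⟩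
  fromℕ (χ * χ)                 ≡⟨ fromℕ-* χ χ ⟩
  fromℕ χ ℚ.* fromℕ χ           ∎
  where
  open ℚ.≤-Reasoning
  r : ℕ
  r = root k
  s : ℕ
  s = 2 + r
  a : ℚ
  a = 1ℚ - deviation r
  a²≥0 : ℚ.NonNegative (a ℚ.* a)
  a²≥0 = ℚ.nonNegative (subst (ℚ._≤ a ℚ.* a) (ℚ.*-zeroʳ a)
    (ℚ.*-monoˡ-≤-nonNeg a {{ℚ.nonNegative 0≤a}} 0≤a))

-- Lower bound by rainbow independent sets.

module RainbowSets {k N : ℕ} (U : UniversalForest k (suc N))
  (f : Colouring (order U) c) (proper : IsProper (universalGraph U) f) where

  open LabelledForest (forest U) (label U) using (_↝_; ↝-depth; Admissible)
  open RootedForest (forest U) hiding (depth; closure)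
  open ForestProperties (forest U)

  V : Set
  V = Fin (order U)

  Above : Maybe V → V → Set
  Above nothing  y = ⊥
  Above (just w) y = y IsAncestorOf w

  above-unique : ∀ p {y z} → Above p y → Above p z → vertexDepth y ≡ vertexDepth z → y ≡ z
  above-unique (just _) = ancestor-unique

  above⇒properAncestor : ∀ {p x y} → parent x ≡ p → Above p y → y IsAncestorOf x × y ≢ x
  above⇒properAncestor {just w} = parent-properAncestor

  properAncestor⇒above : ∀ {p x y} → parent x ≡ p → y IsAncestorOf x → y ≢ x → Above p y
  properAncestor⇒above {p} e q y≢x with properAncestor-parent q y≢x
  ... | w , e′ , q′ with refl ← trans (sym e) e′ = q′

  -- Independence is required for `↝`, not merely for adjacency, because admissibility of a vertex
  -- joined to the set is stated with `↝`.
  record Rainbow (p : Maybe V) (I : Fin m → V) : Set where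
    field
      above       : ∀ i → Above p (I i)
      independent : ∀ i j → ¬ (I i ↝ I j)
      distinct    : Injective _≡_ _≡_ (f ∘ I)

  open Rainbow

  module _ {p : Maybe V} (height<k : height p < k) {I : Fin m → V} (R : Rainbow p I)
    (J : Subset m) where

    private
      AtDepth : ℕ → Pred (Fin m) 0ℓ
      AtDepth j i = i ∈ J × vertexDepth (I i) ≡ j

      atDepth? : ∀ j → Unary.Decidable (AtDepth j)
      atDepth? j i = i ∈? J ×-dec vertexDepth (I i) ℕ.≟ j

      depths : ℕ → Bool
      depths j = does (any? (atDepth? j))

    -- The members lie on one root path, so marking the depths of those indexed by `J` selects
    -- exactly them. Their independence makes `x` admissible, so these edges are present and
    -- properness separates the colours.
    joinedVertex : ∃[ x ] parent x ≡ p × (∀ {y} → x ↝ y → ∃[ i ] i ∈ J × I i ≡ y) ×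
      (∀ {i} → i ∈ J → f x ≢ f (I i))
    joinedVertex with children U p depths height<k
    ... | xs , _ , spec = x , par , out , λ {i} i∈J eq →
      proper x (I i) (inj₁ (edge i∈J , admissible)) eq
      where
      x = xs zero

      par : parent x ≡ p
      par = proj₁ (spec zero)

      label-x : ∀ {y} → y IsAncestorOf x → y ≢ x →
        label U x (vertexDepth y) ≡ depths (vertexDepth y)
      label-x q y≢x = proj₂ (spec zero) (ℕ.≤-trans (properAncestor-depth q y≢x)
        (ℕ.≤-trans (vertexDepth≤depth x) (depth≤k U)))

      out : ∀ {y} → x ↝ y → ∃[ i ] i ∈ J × I i ≡ y
      out {y} (q , y≢x , t) =
        let i , i∈J , eq = does⇒ (any? (atDepth? (vertexDepth y))) (trans (sym (label-x q y≢x)) t)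
        in i , i∈J , above-unique p (above R i) (properAncestor⇒above par q y≢x) eq

      edge : ∀ {i} → i ∈ J → x ↝ I i
      edge {i} i∈J = let q , y≢x = above⇒properAncestor par (above R i) in
        q , y≢x , trans (label-x q y≢x)
          (dec-true (any? (atDepth? (vertexDepth (I i)))) (i , i∈J , refl))

      admissible : Admissible x
      admissible y z xy xz yz with out xy | out xz
      ... | i , _ , refl | j , _ , refl = independent R i j yz

  -- The old rainbow set I is being replaced by K, the members indexed by J
  -- having been exchanged for later vertices of the same colour.
  record Exchange (p : Maybe V) (I K : Fin m → V) (J : Subset m) : Set where
    field
      old        : Rainbow p I
      new        : Rainbow p K
      sameColour : ∀ i → f (K i) ≡ f (I i)
      kept       : ∀ {i} → i ∉ J → K i ≡ I i
      fresh      : ∀ {i} → i ∈ J → ∀ j → K i ≢ I j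

  open Exchange

  BiggerRainbow : ℕ → ℕ → Set
  BiggerRainbow m h = ∃[ p ] height p ≤ h × Σ[ I ∈ (Fin (suc m) → V) ] Rainbow p I

  module _ {p : Maybe V} {I K : Fin m → V} {J : Subset m} (E : Exchange p I K J) {x : V}
    (par : parent x ≡ p) (out : ∀ {y} → x ↝ y → ∃[ i ] i ∈ J × I i ≡ y) where

    private
      below : ∀ {y} → Above p y → vertexDepth y < vertexDepth x
      below {y} a = let q , y≢x = above⇒properAncestor par a in properAncestor-depth q y≢x

      -- `x` points only to old members indexed by `J`, and these have left `K`: an exchanged `K j`
      -- is fresh, while an unexchanged one has another colour.
      x↝̸K : ∀ j → ¬ (x ↝ K j)
      x↝̸K j xK with out xK
      ... | i , i∈J , eq with j ∈? J
      ...   | yes j∈J = fresh E j∈J i (sym eq)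
      ...   | no  j∉J = j∉J (subst (_∈ J)
        (distinct (old E) (cong f (trans eq (kept E j∉J)))) i∈J)

      K↝̸x : ∀ i → ¬ (K i ↝ x)
      K↝̸x i Kx = ℕ.<-asym (↝-depth Kx) (below (above (new E) i))

      K-above : ∀ i → K i IsAncestorOf x
      K-above i = proj₁ (above⇒properAncestor par (above (new E) i))

    adjoin : (∀ i → f x ≢ f (K i)) → Σ[ I′ ∈ (Fin (suc m) → V) ] Rainbow (just x) I′
    adjoin newColour = I′ , record
      { above       = λ { zero → ε ; (suc i) → K-above i }
      ; independent = λ { zero    zero    (_ , x≢x , _) → x≢x refl
                        ; zero    (suc j) → x↝̸K j
                        ; (suc i) zero    → K↝̸x i
                        ; (suc i) (suc j) → independent (new E) i j }
      ; distinct    = λ { {zero}  {zero}  eq → refl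
                        ; {zero}  {suc j} eq → contradiction eq (newColour j)
                        ; {suc i} {zero}  eq → contradiction (sym eq) (newColour i)
                        ; {suc i} {suc j} eq → cong suc (distinct (new E) eq) } }
      where
      I′ : Fin (suc m) → V
      I′ zero    = x
      I′ (suc i) = K i

    module _ (i : Fin m) (fx≡ : f x ≡ f (K i)) where

      replaced : Fin m → V
      replaced j with j Fin.≟ i
      ... | yes _ = x
      ... | no  _ = K j

      private
        sameColours : ∀ j → f (replaced j) ≡ f (K j)
        sameColours j with j Fin.≟ i
        ... | yes refl = fx≡
        ... | no  _    = refl

        replaced-above : ∀ j → replaced j IsAncestorOf x
        replaced-above j with j Fin.≟ i
        ... | yes _ = ε
        ... | no  _ = K-above j

        replaced-independent : ∀ j l → ¬ (replaced j ↝ replaced l)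
        replaced-independent j l with j Fin.≟ i | l Fin.≟ i
        ... | yes _ | yes _ = λ (_ , x≢x , _) → x≢x refl
        ... | yes _ | no  _ = x↝̸K l
        ... | no  _ | yes _ = K↝̸x j
        ... | no  _ | no  _ = independent (new E) j l

        replaced-kept : ∀ {j} → j ∉ J ∪ ⁅ i ⁆ → replaced j ≡ I j
        replaced-kept {j} j∉ with j Fin.≟ i
        ... | yes refl = contradiction (x∈p∪q⁺ (inj₂ (x∈⁅x⁆ i))) j∉
        ... | no  _    = kept E (j∉ ∘ x∈p∪q⁺ ∘ inj₁)

        replaced-fresh : ∀ {j} → j ∈ J ∪ ⁅ i ⁆ → ∀ l → replaced j ≢ I l
        replaced-fresh {j} j∈ l with j Fin.≟ i
        -- `x` lies strictly below every old member.
        ... | yes _   = λ eq → ℕ.<⇒≢ (below (above (old E) l)) (cong vertexDepth (sym eq))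
        ... | no  j≢i with x∈p∪q⁻ J ⁅ i ⁆ j∈
        ...   | inj₁ j∈J = fresh E j∈J l
        ...   | inj₂ j∈i = contradiction (x∈⁅y⁆⇒x≡y i j∈i) j≢i

      replace : Exchange (just x) I replaced (J ∪ ⁅ i ⁆)
      replace = record
        { old        = record
          { above       = λ j → proj₁ (above⇒properAncestor par (above (old E) j))
          ; independent = independent (old E)
          ; distinct    = distinct (old E) }
        ; new        = record
          { above       = replaced-above
          ; independent = replaced-independent
          ; distinct    = λ {j} {l} eq → distinct (new E)
              (trans (sym (sameColours j)) (trans eq (sameColours l))) }
        ; sameColour = λ j → trans (sameColours j) (sameColour E j)
        ; kept       = replaced-kept
        ; fresh      = replaced-fresh }

  -- `r` bounds the number of members not yet exchanged. A repeated colour belongs to a member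
  -- outside `J`, since `x` is joined to the old members over `J`; so `J` grows with every exchange,
  -- each costing one level.
  exchange : ∀ r {p} {I K : Fin m → V} {J} → m ≤ ∣ J ∣ + r → height p + suc r ≤ k →
    Exchange p I K J → BiggerRainbow m (height p + suc r)
  exchange {m} r {p} {I} {K} {J} m≤ h≤ E
    with joinedVertex (ℕ.≤-trans (ℕ.m<m+n (height p) (s≤s z≤n)) h≤) (old E) J
  ... | x , par , out , x≢J with any? (λ i → f x Fin.≟ f (K i))
  ...   | no newColour = just x ,
          subst (_≤ height p + suc r) (sym (trans (vertexDepth-parent x) (cong (suc ∘ height) par)))
            (ℕ.m<m+n (height p) (s≤s z≤n)) ,
          adjoin E par out (λ i eq → newColour (i , eq))
  ...   | yes (i , fx≡fKi) = next r m≤ h≤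
    where
    i∉J : i ∉ J
    i∉J i∈J = x≢J i∈J (trans fx≡fKi (sameColour E i))

    next : ∀ r → m ≤ ∣ J ∣ + r → height p + suc r ≤ k → BiggerRainbow m (height p + suc r)
    -- All members have been exchanged, so a repeated colour is impossible.
    next zero m≤ _ = contradiction (subst (i ∈_) (sym full) ∈⊤) i∉J
      where
      full : J ≡ ⊤
      full = ∣p∣≡n⇒p≡⊤ (ℕ.≤-antisym (∣p∣≤n J) (subst (m ≤_) (ℕ.+-identityʳ _) m≤))
    next (suc r) m≤ h≤ = subst (BiggerRainbow m) shift
      (exchange r (ℕ.≤-trans m≤ (subst (_≤ ∣ J ∪ ⁅ i ⁆ ∣ + r) (sym (ℕ.+-suc ∣ J ∣ r))
          (ℕ.+-monoˡ-≤ r grows)))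
        (subst (_≤ k) (sym shift) h≤) (replace E par out i fx≡fKi))
      where
      shift : vertexDepth x + suc r ≡ height p + suc (suc r)
      shift = trans (cong (_+ suc r) (trans (vertexDepth-parent x) (cong (suc ∘ height) par)))
        (sym (ℕ.+-suc (height p) (suc r)))

      grows : ∣ J ∣ < ∣ J ∪ ⁅ i ⁆ ∣
      grows = p⊂q⇒∣p∣<∣q∣ (p⊆p∪q ⁅ i ⁆ , i , x∈p∪q⁺ (inj₂ (x∈⁅x⁆ i)) , i∉J)

  -- Passing from `m` to `m + 1` vertices takes at most `m` exchanges and one new colour, hence at
  -- most `m + 1` levels.
  rainbow : ∀ m → triangular m ≤ k →
    ∃[ p ] height p ≤ triangular m × Σ[ I ∈ (Fin m → V) ] Rainbow p I
  rainbow zero    _  = nothing , z≤n , (λ ()) ,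
    record { above = λ () ; independent = λ () ; distinct = λ { {()} } }
  rainbow (suc m) t≤ with rainbow m (ℕ.≤-trans (ℕ.m≤m+n _ _) t≤)
  ... | p , h≤ , I , R with exchange m {J = ∅} (ℕ.m≤n+m m _) (ℕ.≤-trans (ℕ.+-monoˡ-≤ _ h≤) t≤)
    (record { old = R ; new = R ; sameColour = λ _ → refl ; kept = λ _ → refl
            ; fresh = λ i∈ → contradiction i∈ ∉⊥ })
  ...   | p′ , h′≤ , R′ = p′ , ℕ.≤-trans h′≤ (ℕ.+-monoˡ-≤ _ h≤) , R′

  rainbow≤colours : ∀ m → triangular m ≤ k → m ≤ c
  rainbow≤colours m t≤ = let _ , _ , _ , R = rainbow m t≤ in Fin.injective⇒≤ (distinct R)

-- Equality of the three chromatic numbers.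

proper? : (G : Graph n) (f : Colouring n c) → Dec (IsProper G f)
proper? G f = all? λ u → all? λ v → adj? G u v →-dec ¬? (f u Fin.≟ f v)

colourable? : (G : Graph n) → Unary.Decidable (λ c → Σ[ f ∈ Colouring n c ] IsProper G f)
colourable? G c = anyFunction?
  (λ f≗g proper u v a eq → proper u v a (trans (f≗g u) (trans eq (sym (f≗g v))))) (proper? G)

module _ (k : ℕ) where

  extremalForest : ∀ d → UniversalForest k (suc (k * d))
  extremalForest d = universalForest k (suc (k * d))

  extremal : ∀ d → Graph (order (extremalForest d))
  extremal d = universalGraph (extremalForest d)

  extremal∈class : ∀ d → TriangleFreeTreedepth≤ k (extremal d)
  extremal∈class d = labelledGraph-triangleFree ,
    let t , isTreedepth , t≤ = treedepth-exists (extremal d) (forest U) labelledGraph⊆closure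
    in t , isTreedepth , ℕ.≤-trans t≤ (depth≤k U)
    where
    U = extremalForest d
    open LabelledForest (forest U) (label U)

  -- One colouring of the single graph `extremal d` serves the whole class, with no additional
  -- colours.
  defective⇒proper : ∀ {d} (f : Colouring (order (extremalForest d)) c) →
    HasDefect (extremal d) f d →
    (G : Graph n) → TriangleFreeTreedepth≤ k G → Σ[ h ∈ Colouring n c ] IsProper G h
  defective⇒proper {d = d} f defect G (triangleFree , t , ((F , depth≡t , spans) , _) , t≤k) =
    Embedding.properColouring (extremalForest d) f defect G triangleFree F
      (ℕ.≤-trans (ℕ.≤-reflexive depth≡t) t≤k) spans

  opaque
    -- The parameter is 1 because a proper colouring has clustering 1, and `clustering⇒defect` turns
    -- this into defect 1.
    extremal-chromatic : ∃ (IsChromaticNumber (extremal 1))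
    extremal-chromatic = least (colourable? (extremal 1))
      -- Giving each vertex its own colour bounds the search.
      {order (extremalForest 1)} (id , λ u v a u≡v →
        irrefl (extremal 1) u (subst (Adj (extremal 1) u) (sym u≡v) a))

  χ : ℕ
  χ = proj₁ extremal-chromatic

  χ-proper : (G : Graph n) → TriangleFreeTreedepth≤ k G → Σ[ h ∈ Colouring n χ ] IsProper G h
  χ-proper = let f , proper = proj₁ (proj₂ extremal-chromatic) in
    defective⇒proper f (clustering⇒defect (extremal 1) f (proper⇒clustering (extremal 1) f proper))

  χ-least : ∀ {j} → Σ[ f ∈ Colouring (order (extremalForest 1)) j ] IsProper (extremal 1) f → χ ≤ j
  χ-least = proj₂ (proj₂ extremal-chromatic) _

  -- A colouring of `extremal d` with defect `d` is converted into a proper colouring of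
  -- `extremal 1`, itself a member of the class.
  χ-defect : ∀ j d → (∀ {n} (G : Graph n) → TriangleFreeTreedepth≤ k G →
    Σ[ f ∈ Colouring n j ] HasDefect G f d) → χ ≤ j
  χ-defect j d defective = let f , defect = defective (extremal d) (extremal∈class d) in
    χ-least (defective⇒proper f defect (extremal 1) (extremal∈class 1))

  χ-clustering : (G : Graph n) → TriangleFreeTreedepth≤ k G →
    Σ[ f ∈ Colouring n χ ] HasClustering G f 1
  χ-clustering G G∈ = let f , proper = χ-proper G G∈ in f , proper⇒clustering G f proper

  class-chromatic : IsClassChromaticNumber (TriangleFreeTreedepth≤ k) χ
  class-chromatic = (_ , extremal 1 , extremal∈class 1 , proj₂ extremal-chromatic) ,
    λ { j (n , G , G∈ , _ , min) → min χ (χ-proper G G∈) }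

  class-defective : IsDefectiveChromaticNumber (TriangleFreeTreedepth≤ k) χ
  class-defective =
    (1 , λ G G∈ → let f , clustered = χ-clustering G G∈ in f , clustering⇒defect G f clustered) ,
    λ { j (d , defective) → χ-defect j d defective }

  class-clustered : IsClusteredChromaticNumber (TriangleFreeTreedepth≤ k) χ
  class-clustered = (1 , χ-clustering) ,
    λ { j (s , clustered) → χ-defect j s λ G G∈ →
          let f , clustering = clustered G G∈ in f , clustering⇒defect G f clustering }

  root≤χ : root k ≤ χ
  root≤χ = let f , proper = proj₁ (proj₂ extremal-chromatic) in
    RainbowSets.rainbow≤colours (extremalForest 1) f proper (root k)
      (proj₁ (proj₂ (triangularRoot k)))

  χ≤ : χ ≤ ⌈ k + 2 /2⌉
  χ≤ = χ-least (FirstFit.firstFitColouring (extremal 1) labelledGraph-triangleFree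
    (forest U) labelledGraph⊆closure (depth≤k U))
    where
    U = extremalForest 1
    open LabelledForest (forest U) (label U)

corollary11 : Σ[ χ ∈ (ℕ → ℕ) ] Σ[ o ∈ (ℕ → ℚ) ] TendsToZero o ×
    (∀ (k : ℕ) → k ≥ 1 →
    IsClassChromaticNumber (TriangleFreeTreedepth≤ k) (χ k) ×
    IsDefectiveChromaticNumber (TriangleFreeTreedepth≤ k) (χ k) ×
    IsClusteredChromaticNumber (TriangleFreeTreedepth≤ k) (χ k) ×
    ((1ℚ - o k) ·√ (2 * k) ≤ χ k) ×
    χ k ≤ ⌈ k + 2 /2⌉)
corollary11 = χ , deviation ∘ root , deviation→0 , λ k _ →
  class-chromatic k , class-defective k , class-clustered k ,
  deviation-√ k (χ k) (root≤χ k) , χ≤ k
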